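{- Let $d$ be a square-free rational integer with $d\not\equiv 1\pmod 4$, let $K=\mathbb{Q}(\sqrt{d})$ with ring of algebraic integers $O_{K}=\mathbb{Z}[\sqrt{d}]$, and let $\sigma,\tau$ be two different non-zero ring endomorphisms of $O_{K}$. Let $D:O_{K}\to O_{K}$ be a $(\sigma,\tau)$-derivation with $D(\sqrt{d})=c_{0}+c_{1}\sqrt{d}$, where $c_{0},c_{1}\in\mathbb{Z}$. Then $D$ is inner if and only if $c_{0}$ is divisible by $2d$ and $c_{1}$ is even. In particular: (i) $D$ is inner if $2d$ divides both $c_{0}$ and $c_{1}$; (ii) $O_{K}$ has non-trivial outer $(\sigma,\tau)$-derivations, that is, $\mathrm{Out}_{(\sigma,\tau)}(O_{K})\neq\{0\}$.
   Context: $O_{K}$ is regarded as a commutative unital $\mathbb{Z}$-algebra. A $(\sigma,\tau)$-derivation of $O_{K}$ is a $\mathbb{Z}$-linear map $D:O_{K}\to O_{K}$ with $D(xy)=D(x)\tau(y)+\sigma(x)D(y)$ for all $x,y\in O_{K}$. It is called inner if there exists $\beta\in O_{K}$ with $D(x)=\beta\tau(x)-\sigma(x)\beta$ for all $x\in O_{K}$. $\mathrm{Out}_{(\sigma,\tau)}(O_{K})$ denotes the quotient of the $\mathbb{Z}$-module $\mathcal{D}_{(\sigma,\tau)}(O_{K})$ of all $(\sigma,\tau)$-derivations by the submodule $\mathrm{Inn}_{(\sigma,\tau)}(O_{K})$ of inner ones. -}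

module Defs where

open import Level using (0ℓ; suc; _⊔_)
open import Algebra.Bundles using (Ring; CommutativeRing; CommutativeMonoid)
open import Algebra.Module.Bundles using (LeftModule)
open import Algebra.Module.Morphism.Structures using (module LeftModuleMorphisms)
open import Algebra.Morphism.Structures using (module RingWithoutOneMorphisms)
import Algebra.Properties.AbelianGroup as AbelianGroupProperties
import Algebra.Properties.CommutativeSemigroup as CommutativeSemigroupProperties
open import Data.Integer using (ℤ; +_; 0ℤ; 1ℤ; ∣_∣; _+_; _*_; -_; _-_)
open import Data.Integer.Divisibility.Signed using (_∣_)
open import Data.Integer.Properties using (+-*-ring)
open import Data.Integer.Tactic.RingSolver using (solve-∀)
open import Data.Product using (∃-syntax; _,_)
open import Relation.Nullary using (¬_)
open import Relation.Binary.PropositionalEquality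
  using (_≡_; refl; sym; trans; cong; cong₂; isEquivalence)

-- In particular 0 is not square-free.
SquareFree : ℤ → Set
SquareFree d = ∀ n → n * n ∣ d → ∣ n ∣ ≡ 1

module _ {r ℓr m ℓm} {R : Ring r ℓr} (M : LeftModule R m ℓm) where

  open LeftModule M

  record Submodule p : Set (r ⊔ m ⊔ ℓm ⊔ suc p) where
    field
      Member : Carrierᴹ → Set p
      resp   : ∀ {x y} → x ≈ᴹ y → Member x → Member y
      0-mem  : Member 0ᴹ
      +-mem  : ∀ {x y} → Member x → Member y → Member (x +ᴹ y)
      *ₗ-mem : ∀ k {x} → Member x → Member (k *ₗ x)

-- M / N has the elements of M, two of them being equal when their
-- difference lies in N.
module _ {r ℓr m ℓm p} {R : Ring r ℓr}
         (M : LeftModule R m ℓm) (N : Submodule M p) where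

  open LeftModule M
  open Submodule N
  open AbelianGroupProperties +ᴹ-abelianGroup
    using (⁻¹-∙-comm; ⁻¹-anti-homo‿-)
    renaming (inverseʳ-unique to neg-unique)
  open CommutativeSemigroupProperties
    (CommutativeMonoid.commutativeSemigroup +ᴹ-commutativeMonoid)
    using (interchange)

  private
    module R = Ring R
    infix 4 _∼_
    _∼_ : Carrierᴹ → Carrierᴹ → Set p
    x ∼ y = Member (x +ᴹ -ᴹ y)

    -1*x : ∀ x → R.- R.1# *ₗ x ≈ᴹ -ᴹ x
    -1*x x = neg-unique x (R.- R.1# *ₗ x)
      (≈ᴹ-trans (+ᴹ-cong (≈ᴹ-sym (*ₗ-identityˡ x)) ≈ᴹ-refl)
      (≈ᴹ-trans (≈ᴹ-sym (*ₗ-distribʳ x R.1# (R.- R.1#)))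
      (≈ᴹ-trans (*ₗ-cong (R.-‿inverseʳ R.1#) ≈ᴹ-refl) (*ₗ-zeroˡ x))))

    neg-mem : ∀ {x} → Member x → Member (-ᴹ x)
    neg-mem {x} h = resp (-1*x x) (*ₗ-mem (R.- R.1#) h)

    ≈⇒∼ : ∀ {x y} → x ≈ᴹ y → x ∼ y
    ≈⇒∼ {x} {y} e = resp
      (≈ᴹ-sym (≈ᴹ-trans (+ᴹ-cong e ≈ᴹ-refl) (-ᴹ‿inverseʳ y))) 0-mem

    ∼-sym : ∀ {x y} → x ∼ y → y ∼ x
    ∼-sym {x} {y} h = resp (⁻¹-anti-homo‿- x y) (neg-mem h)

    ∼-trans : ∀ {x y z} → x ∼ y → y ∼ z → x ∼ z
    ∼-trans {x} {y} {z} h k = resp eq (+-mem h k)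
      where
      eq : (x +ᴹ -ᴹ y) +ᴹ (y +ᴹ -ᴹ z) ≈ᴹ x +ᴹ -ᴹ z
      eq = ≈ᴹ-trans (+ᴹ-assoc x (-ᴹ y) (y +ᴹ -ᴹ z))
             (+ᴹ-cong ≈ᴹ-refl
               (≈ᴹ-trans (≈ᴹ-sym (+ᴹ-assoc (-ᴹ y) y (-ᴹ z)))
               (≈ᴹ-trans (+ᴹ-cong (-ᴹ‿inverseˡ y) ≈ᴹ-refl)
                         (+ᴹ-identityˡ (-ᴹ z)))))

    +-∼ : ∀ {x y u v} → x ∼ y → u ∼ v → x +ᴹ u ∼ y +ᴹ v
    +-∼ {x} {y} {u} {v} h k = resp
      (≈ᴹ-trans (interchange x (-ᴹ y) u (-ᴹ v))
                (+ᴹ-cong ≈ᴹ-refl (⁻¹-∙-comm y v)))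
      (+-mem h k)

    neg-∼ : ∀ {x y} → x ∼ y → -ᴹ x ∼ -ᴹ y
    neg-∼ {x} {y} h = resp (≈ᴹ-sym (⁻¹-∙-comm x (-ᴹ y))) (neg-mem h)

    *ₗ-neg : ∀ k x → k *ₗ -ᴹ x ≈ᴹ -ᴹ (k *ₗ x)
    *ₗ-neg k x = neg-unique (k *ₗ x) (k *ₗ -ᴹ x)
      (≈ᴹ-trans (≈ᴹ-sym (*ₗ-distribˡ k x (-ᴹ x)))
      (≈ᴹ-trans (*ₗ-cong R.refl (-ᴹ‿inverseʳ x)) (*ₗ-zeroʳ k)))

    *ₗ-∼ : ∀ {k l x y} → k R.≈ l → x ∼ y → k *ₗ x ∼ l *ₗ y
    *ₗ-∼ {k} {l} {x} {y} e h = resp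
      (≈ᴹ-trans (*ₗ-distribˡ k x (-ᴹ y))
        (+ᴹ-cong ≈ᴹ-refl
          (≈ᴹ-trans (*ₗ-cong e ≈ᴹ-refl) (*ₗ-neg l y))))
      (*ₗ-mem k h)

  quotient : LeftModule R m p
  quotient = record
    { Carrierᴹ = Carrierᴹ
    ; _≈ᴹ_ = _∼_
    ; _+ᴹ_ = _+ᴹ_
    ; _*ₗ_ = _*ₗ_
    ; 0ᴹ = 0ᴹ
    ; -ᴹ_ = -ᴹ_
    ; isLeftModule = record
      { isLeftSemimodule = record
        { +ᴹ-isCommutativeMonoid = record
          { isMonoid = record
            { isSemigroup = record
              { isMagma = record
                { isEquivalence = record
                  { refl = ≈⇒∼ ≈ᴹ-refl ; sym = ∼-sym ; trans = ∼-trans }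
                ; ∙-cong = +-∼
                }
              ; assoc = λ x y z → ≈⇒∼ (+ᴹ-assoc x y z)
              }
            ; identity = (λ x → ≈⇒∼ (+ᴹ-identityˡ x))
                       , (λ x → ≈⇒∼ (+ᴹ-identityʳ x))
            }
          ; comm = λ x y → ≈⇒∼ (+ᴹ-comm x y)
          }
        ; isPreleftSemimodule = record
          { *ₗ-cong = *ₗ-∼
          ; *ₗ-zeroˡ = λ x → ≈⇒∼ (*ₗ-zeroˡ x)
          ; *ₗ-distribʳ = λ x k l → ≈⇒∼ (*ₗ-distribʳ x k l)
          ; *ₗ-identityˡ = λ x → ≈⇒∼ (*ₗ-identityˡ x)
          ; *ₗ-assoc = λ k l x → ≈⇒∼ (*ₗ-assoc k l x)
          ; *ₗ-zeroʳ = λ k → ≈⇒∼ (*ₗ-zeroʳ k)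
          ; *ₗ-distribˡ = λ k x y → ≈⇒∼ (*ₗ-distribˡ k x y)
          }
        }
      ; -ᴹ‿cong = neg-∼
      ; -ᴹ‿inverse = (λ x → ≈⇒∼ (-ᴹ‿inverseˡ x))
                   , (λ x → ≈⇒∼ (-ᴹ‿inverseʳ x))
      }
    }

NonTrivial : ∀ {r ℓr m ℓm} {R : Ring r ℓr} → LeftModule R m ℓm → Set (m ⊔ ℓm)
NonTrivial M = ∃[ x ] ¬ (x ≈ᴹ 0ᴹ)
  where open LeftModule M

-- a +√ b stands for a + b√d.  For d square-free with d ≢ 1 (mod 4) this
-- is the ring of algebraic integers of ℚ(√d).  Propositional equality is the
-- right one because 1 and √d are linearly independent for such d.
infix 5 _+√_
record ℤ[√_] (d : ℤ) : Set where
  constructor _+√_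
  field
    re im : ℤ

open ℤ[√_] public

√_ : (d : ℤ) → ℤ[√ d ]
√ d = 0ℤ +√ 1ℤ

module _ {d : ℤ} where

  infixl 6 _⊕_
  infixl 7 _⊗_
  infixr 7 _•_
  infix  8 ⊖_

  𝟘 𝟙 : ℤ[√ d ]
  𝟘 = 0ℤ +√ 0ℤ
  𝟙 = 1ℤ +√ 0ℤ

  _⊕_ _⊗_ : ℤ[√ d ] → ℤ[√ d ] → ℤ[√ d ]
  (a +√ b) ⊕ (a′ +√ b′) = a + a′ +√ b + b′
  (a +√ b) ⊗ (a′ +√ b′) = a * a′ + d * (b * b′) +√ a * b′ + b * a′

  ⊖_ : ℤ[√ d ] → ℤ[√ d ]
  ⊖ (a +√ b) = - a +√ - b

  _•_ : ℤ → ℤ[√ d ] → ℤ[√ d ]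
  n • (a +√ b) = n * a +√ n * b

module _ (d : ℤ) where

  private
    ⊕-assoc : (x y z : ℤ[√ d ]) → (x ⊕ y) ⊕ z ≡ x ⊕ (y ⊕ z)
    ⊕-assoc (a +√ b) (a′ +√ b′) (a″ +√ b″) =
      cong₂ _+√_ (lem a a′ a″) (lem b b′ b″)
      where
      lem : ∀ i j k → (i + j) + k ≡ i + (j + k)
      lem = solve-∀

    ⊕-comm : (x y : ℤ[√ d ]) → x ⊕ y ≡ y ⊕ x
    ⊕-comm (a +√ b) (a′ +√ b′) = cong₂ _+√_ (lem a a′) (lem b b′)
      where
      lem : ∀ i j → i + j ≡ j + i
      lem = solve-∀

    ⊕-identityˡ : (x : ℤ[√ d ]) → 𝟘 ⊕ x ≡ x
    ⊕-identityˡ (a +√ b) = cong₂ _+√_ (lem a) (lem b)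
      where
      lem : ∀ i → 0ℤ + i ≡ i
      lem = solve-∀

    ⊖-inverseˡ : (x : ℤ[√ d ]) → ⊖ x ⊕ x ≡ 𝟘
    ⊖-inverseˡ (a +√ b) = cong₂ _+√_ (lem a) (lem b)
      where
      lem : ∀ i → - i + i ≡ 0ℤ
      lem = solve-∀

    ⊗-assoc : (x y z : ℤ[√ d ]) → (x ⊗ y) ⊗ z ≡ x ⊗ (y ⊗ z)
    ⊗-assoc (a +√ b) (a′ +√ b′) (a″ +√ b″) =
      cong₂ _+√_ (lem₁ d a b a′ b′ a″ b″) (lem₂ d a b a′ b′ a″ b″)
      where
      lem₁ : ∀ d a b a′ b′ a″ b″ →
        (a * a′ + d * (b * b′)) * a″ + d * ((a * b′ + b * a′) * b″) ≡
        a * (a′ * a″ + d * (b′ * b″)) + d * (b * (a′ * b″ + b′ * a″))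
      lem₁ = solve-∀
      lem₂ : ∀ d a b a′ b′ a″ b″ →
        (a * a′ + d * (b * b′)) * b″ + (a * b′ + b * a′) * a″ ≡
        a * (a′ * b″ + b′ * a″) + b * (a′ * a″ + d * (b′ * b″))
      lem₂ = solve-∀

    ⊗-comm : (x y : ℤ[√ d ]) → x ⊗ y ≡ y ⊗ x
    ⊗-comm (a +√ b) (a′ +√ b′) =
      cong₂ _+√_ (lem₁ d a b a′ b′) (lem₂ a b a′ b′)
      where
      lem₁ : ∀ d a b a′ b′ → a * a′ + d * (b * b′) ≡ a′ * a + d * (b′ * b)
      lem₁ = solve-∀
      lem₂ : ∀ a b a′ b′ → a * b′ + b * a′ ≡ a′ * b + b′ * a
      lem₂ = solve-∀

    ⊗-identityˡ : (x : ℤ[√ d ]) → 𝟙 ⊗ x ≡ x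
    ⊗-identityˡ (a +√ b) = cong₂ _+√_ (lem₁ d a b) (lem₂ a b)
      where
      lem₁ : ∀ d a b → 1ℤ * a + d * (0ℤ * b) ≡ a
      lem₁ = solve-∀
      lem₂ : ∀ a b → 1ℤ * b + 0ℤ * a ≡ b
      lem₂ = solve-∀

    ⊗-distribˡ : (x y z : ℤ[√ d ]) → x ⊗ (y ⊕ z) ≡ (x ⊗ y) ⊕ (x ⊗ z)
    ⊗-distribˡ (a +√ b) (a′ +√ b′) (a″ +√ b″) =
      cong₂ _+√_ (lem₁ d a b a′ b′ a″ b″) (lem₂ a b a′ b′ a″ b″)
      where
      lem₁ : ∀ d a b a′ b′ a″ b″ → a * (a′ + a″) + d * (b * (b′ + b″)) ≡
        (a * a′ + d * (b * b′)) + (a * a″ + d * (b * b″))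
      lem₁ = solve-∀
      lem₂ : ∀ a b a′ b′ a″ b″ → a * (b′ + b″) + b * (a′ + a″) ≡
        (a * b′ + b * a′) + (a * b″ + b * a″)
      lem₂ = solve-∀

    ⊗-distribʳ : (x y z : ℤ[√ d ]) → (y ⊕ z) ⊗ x ≡ (y ⊗ x) ⊕ (z ⊗ x)
    ⊗-distribʳ x y z = trans (⊗-comm (y ⊕ z) x)
      (trans (⊗-distribˡ x y z) (cong₂ _⊕_ (⊗-comm x y) (⊗-comm x z)))

  commutativeRing : CommutativeRing 0ℓ 0ℓ
  commutativeRing = record
    { Carrier = ℤ[√ d ]
    ; _≈_ = _≡_
    ; _+_ = _⊕_
    ; _*_ = _⊗_
    ; -_ = ⊖_
    ; 0# = 𝟘
    ; 1# = 𝟙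
    ; isCommutativeRing = record
      { isRing = record
        { +-isAbelianGroup = record
          { isGroup = record
            { isMonoid = record
              { isSemigroup = record
                { isMagma = record
                  { isEquivalence = isEquivalence ; ∙-cong = cong₂ _⊕_ }
                ; assoc = ⊕-assoc
                }
              ; identity = ⊕-identityˡ
                         , λ x → trans (⊕-comm x 𝟘) (⊕-identityˡ x)
              }
            ; inverse = ⊖-inverseˡ
                      , λ x → trans (⊕-comm x (⊖ x)) (⊖-inverseˡ x)
            ; ⁻¹-cong = cong ⊖_
            }
          ; comm = ⊕-comm
          }
        ; *-cong = cong₂ _⊗_
        ; *-assoc = ⊗-assoc
        ; *-identity = ⊗-identityˡ
                     , λ x → trans (⊗-comm x 𝟙) (⊗-identityˡ x)
        ; distrib = ⊗-distribˡ , ⊗-distribʳ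
        }
      ; *-comm = ⊗-comm
      }
    }

  private
    module A = CommutativeRing commutativeRing

    •-zeroˡ : (x : ℤ[√ d ]) → 0ℤ • x ≡ 𝟘
    •-zeroˡ (a +√ b) = cong₂ _+√_ (lem a) (lem b)
      where
      lem : ∀ i → 0ℤ * i ≡ 0ℤ
      lem = solve-∀

    •-zeroʳ : ∀ k → k • 𝟘 ≡ 𝟘 {d}
    •-zeroʳ k = cong₂ _+√_ (lem k) (lem k)
      where
      lem : ∀ i → i * 0ℤ ≡ 0ℤ
      lem = solve-∀

    •-identityˡ : (x : ℤ[√ d ]) → 1ℤ • x ≡ x
    •-identityˡ (a +√ b) = cong₂ _+√_ (lem a) (lem b)
      where
      lem : ∀ i → 1ℤ * i ≡ i
      lem = solve-∀

    •-assoc : ∀ k l (x : ℤ[√ d ]) → (k * l) • x ≡ k • l • x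
    •-assoc k l (a +√ b) = cong₂ _+√_ (lem k l a) (lem k l b)
      where
      lem : ∀ k l i → (k * l) * i ≡ k * (l * i)
      lem = solve-∀

    •-distribʳ : ∀ (x : ℤ[√ d ]) k l → (k + l) • x ≡ (k • x) ⊕ (l • x)
    •-distribʳ (a +√ b) k l = cong₂ _+√_ (lem k l a) (lem k l b)
      where
      lem : ∀ k l i → (k + l) * i ≡ k * i + l * i
      lem = solve-∀

    •-distribˡ : ∀ k (x y : ℤ[√ d ]) → k • (x ⊕ y) ≡ (k • x) ⊕ (k • y)
    •-distribˡ k (a +√ b) (a′ +√ b′) = cong₂ _+√_ (lem k a a′) (lem k b b′)
      where
      lem : ∀ k i j → k * (i + j) ≡ k * i + k * j
      lem = solve-∀

  ℤ-module : LeftModule +-*-ring 0ℓ 0ℓ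
  ℤ-module = record
    { Carrierᴹ = ℤ[√ d ]
    ; _≈ᴹ_ = _≡_
    ; _+ᴹ_ = _⊕_
    ; _*ₗ_ = _•_
    ; 0ᴹ = 𝟘
    ; -ᴹ_ = ⊖_
    ; isLeftModule = record
      { isLeftSemimodule = record
        { +ᴹ-isCommutativeMonoid = A.+-isCommutativeMonoid
        ; isPreleftSemimodule = record
          { *ₗ-cong = cong₂ _•_
          ; *ₗ-zeroˡ = •-zeroˡ
          ; *ₗ-distribʳ = •-distribʳ
          ; *ₗ-identityˡ = •-identityˡ
          ; *ₗ-assoc = •-assoc
          ; *ₗ-zeroʳ = •-zeroʳ
          ; *ₗ-distribˡ = •-distribˡ
          }
        }
      ; -ᴹ‿cong = cong ⊖_
      ; -ᴹ‿inverse = A.-‿inverse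
      }
    }

-- An endomorphism is not assumed to preserve 1: for non-zero endomorphisms
-- of an integral domain this is automatic.
module _ {d : ℤ} where

  open RingWithoutOneMorphisms
    (Ring.rawRingWithoutOne (CommutativeRing.ring (commutativeRing d)))
    (Ring.rawRingWithoutOne (CommutativeRing.ring (commutativeRing d)))
  open LeftModuleMorphisms
    (LeftModule.rawLeftModule (ℤ-module d)) (LeftModule.rawLeftModule (ℤ-module d))

  IsRingEndomorphism : (ℤ[√ d ] → ℤ[√ d ]) → Set
  IsRingEndomorphism = IsRingWithoutOneHomomorphism

  IsNonZero : (ℤ[√ d ] → ℤ[√ d ]) → Set
  IsNonZero σ = ¬ (∀ x → σ x ≡ 𝟘)

  IsℤLinear : (ℤ[√ d ] → ℤ[√ d ]) → Set
  IsℤLinear = IsLeftModuleHomomorphism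

module _ {d : ℤ} (σ τ : ℤ[√ d ] → ℤ[√ d ]) where

  record Derivation : Set where
    field
      D       : ℤ[√ d ] → ℤ[√ d ]
      linear  : IsℤLinear D
      leibniz : ∀ x y → D (x ⊗ y) ≡ (D x ⊗ τ y) ⊕ (σ x ⊗ D y)

  open Derivation

  IsInner : Derivation → Set
  IsInner δ = ∃[ β ] ∀ x → D δ x ≡ (β ⊗ τ x) ⊕ ⊖ (σ x ⊗ β)

  private
    module A where
      open CommutativeRing (commutativeRing d) public
      open CommutativeSemigroupProperties +-commutativeSemigroup public
        using (interchange)
      open AbelianGroupProperties +-abelianGroup public using (⁻¹-∙-comm)
    module M = LeftModule (ℤ-module d)

    -‿⊗ˡ : (x y : ℤ[√ d ]) → (⊖ x) ⊗ y ≡ ⊖ (x ⊗ y)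
    -‿⊗ˡ (a +√ b) (a′ +√ b′) = cong₂ _+√_ (lem₁ d a b a′ b′) (lem₂ a b a′ b′)
      where
      lem₁ : ∀ d a b a′ b′ →
        - a * a′ + d * (- b * b′) ≡ - (a * a′ + d * (b * b′))
      lem₁ = solve-∀
      lem₂ : ∀ a b a′ b′ → - a * b′ + - b * a′ ≡ - (a * b′ + b * a′)
      lem₂ = solve-∀

    •-⊗ˡ : ∀ k (x y : ℤ[√ d ]) → (k • x) ⊗ y ≡ k • (x ⊗ y)
    •-⊗ˡ k (a +√ b) (a′ +√ b′) =
      cong₂ _+√_ (lem₁ d k a b a′ b′) (lem₂ k a b a′ b′)
      where
      lem₁ : ∀ d k a b a′ b′ →
        k * a * a′ + d * (k * b * b′) ≡ k * (a * a′ + d * (b * b′))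
      lem₁ = solve-∀
      lem₂ : ∀ k a b a′ b′ → k * a * b′ + k * b * a′ ≡ k * (a * b′ + b * a′)
      lem₂ = solve-∀

    -‿⊗ʳ : (x y : ℤ[√ d ]) → x ⊗ (⊖ y) ≡ ⊖ (x ⊗ y)
    -‿⊗ʳ x y = trans (A.*-comm x (⊖ y))
      (trans (-‿⊗ˡ y x) (cong ⊖_ (A.*-comm y x)))

    •-⊗ʳ : ∀ k (x y : ℤ[√ d ]) → x ⊗ (k • y) ≡ k • (x ⊗ y)
    •-⊗ʳ k x y = trans (A.*-comm x (k • y))
      (trans (•-⊗ˡ k y x) (cong (k •_) (A.*-comm y x)))

    •-⊖ : ∀ k (x : ℤ[√ d ]) → k • (⊖ x) ≡ ⊖ (k • x)
    •-⊖ k (a +√ b) = cong₂ _+√_ (lem k a) (lem k b)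
      where
      lem : ∀ k i → k * - i ≡ - (k * i)
      lem = solve-∀

    •-comm : ∀ k l (x : ℤ[√ d ]) → k • l • x ≡ l • k • x
    •-comm k l (a +√ b) = cong₂ _+√_ (lem k l a) (lem k l b)
      where
      lem : ∀ k l i → k * (l * i) ≡ l * (k * i)
      lem = solve-∀

  -- Preservation of 0 and of negation, part of IsℤLinear, follows from
  -- ℤ-homogeneity.
  mkDerivation : (f : ℤ[√ d ] → ℤ[√ d ]) →
    (∀ x y → f (x ⊕ y) ≡ f x ⊕ f y) →
    (∀ k x → f (k • x) ≡ k • f x) →
    (∀ x y → f (x ⊗ y) ≡ (f x ⊗ τ y) ⊕ (σ x ⊗ f y)) →
    Derivation
  mkDerivation f add hom leib = record
    { D = f
    ; linear = record
      { +ᴹ-isGroupHomomorphism = record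
        { isMonoidHomomorphism = record
          { isMagmaHomomorphism = record
            { isRelHomomorphism = record { cong = cong f }
            ; homo = add
            }
          ; ε-homo = trans (hom 0ℤ 𝟘) (M.*ₗ-zeroˡ (f 𝟘))
          }
        ; ⁻¹-homo = λ x → trans (cong f (neg x))
            (trans (hom (- 1ℤ) x) (sym (neg (f x))))
        }
      ; *ₗ-homo = hom
      }
    ; leibniz = leib
    }
    where
    neg : (x : ℤ[√ d ]) → ⊖ x ≡ (- 1ℤ) • x
    neg (a +√ b) = cong₂ _+√_ (lem a) (lem b)
      where
      lem : ∀ i → - i ≡ - 1ℤ * i
      lem = solve-∀

  private
    module L (δ : Derivation) where
      open LeftModuleMorphisms.IsLeftModuleHomomorphism (linear δ) public
        using (+ᴹ-homo; *ₗ-homo)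

    infixl 6 _+ᴰ_
    infixr 7 _•ᴰ_

    0ᴰ : Derivation
    0ᴰ = mkDerivation (λ _ → 𝟘) (λ _ _ → refl)
      (λ k _ → sym (M.*ₗ-zeroʳ k))
      (λ x y → sym (cong₂ _⊕_ (A.zeroˡ (τ y)) (A.zeroʳ (σ x))))

    _+ᴰ_ : Derivation → Derivation → Derivation
    δ +ᴰ ε = mkDerivation (λ x → D δ x ⊕ D ε x)
      (λ x y → trans (cong₂ _⊕_ (L.+ᴹ-homo δ x y) (L.+ᴹ-homo ε x y))
        (A.interchange (D δ x) (D δ y) (D ε x) (D ε y)))
      (λ k x → trans (cong₂ _⊕_ (L.*ₗ-homo δ k x) (L.*ₗ-homo ε k x))
        (sym (M.*ₗ-distribˡ k (D δ x) (D ε x))))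
      (λ x y → trans (cong₂ _⊕_ (leibniz δ x y) (leibniz ε x y))
        (trans (A.interchange (D δ x ⊗ τ y) (σ x ⊗ D δ y)
                              (D ε x ⊗ τ y) (σ x ⊗ D ε y))
          (sym (cong₂ _⊕_ (A.distribʳ (τ y) (D δ x) (D ε x))
                          (A.distribˡ (σ x) (D δ y) (D ε y))))))

    -ᴰ_ : Derivation → Derivation
    -ᴰ δ = mkDerivation (λ x → ⊖ D δ x)
      (λ x y → trans (cong ⊖_ (L.+ᴹ-homo δ x y))
        (sym (A.⁻¹-∙-comm (D δ x) (D δ y))))
      (λ k x → trans (cong ⊖_ (L.*ₗ-homo δ k x)) (sym (•-⊖ k (D δ x))))
      (λ x y → trans (cong ⊖_ (leibniz δ x y))
        (trans (sym (A.⁻¹-∙-comm (D δ x ⊗ τ y) (σ x ⊗ D δ y)))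
          (sym (cong₂ _⊕_ (-‿⊗ˡ (D δ x) (τ y)) (-‿⊗ʳ (σ x) (D δ y))))))

    _•ᴰ_ : ℤ → Derivation → Derivation
    k •ᴰ δ = mkDerivation (λ x → k • D δ x)
      (λ x y → trans (cong (k •_) (L.+ᴹ-homo δ x y))
        (M.*ₗ-distribˡ k (D δ x) (D δ y)))
      (λ l x → trans (cong (k •_) (L.*ₗ-homo δ l x)) (•-comm k l (D δ x)))
      (λ x y → trans (cong (k •_) (leibniz δ x y))
        (trans (M.*ₗ-distribˡ k (D δ x ⊗ τ y) (σ x ⊗ D δ y))
          (sym (cong₂ _⊕_ (•-⊗ˡ k (D δ x) (τ y)) (•-⊗ʳ k (σ x) (D δ y))))))

  𝒟 : LeftModule +-*-ring 0ℓ 0ℓ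
  𝒟 = record
    { Carrierᴹ = Derivation
    ; _≈ᴹ_ = λ δ ε → ∀ x → D δ x ≡ D ε x
    ; _+ᴹ_ = _+ᴰ_
    ; _*ₗ_ = _•ᴰ_
    ; 0ᴹ = 0ᴰ
    ; -ᴹ_ = -ᴰ_
    ; isLeftModule = record
      { isLeftSemimodule = record
        { +ᴹ-isCommutativeMonoid = record
          { isMonoid = record
            { isSemigroup = record
              { isMagma = record
                { isEquivalence = record
                  { refl = λ _ → refl
                  ; sym = λ p x → sym (p x)
                  ; trans = λ p q x → trans (p x) (q x)
                  }
                ; ∙-cong = λ p q x → cong₂ _⊕_ (p x) (q x)
                }
              ; assoc = λ δ ε ζ x → A.+-assoc (D δ x) (D ε x) (D ζ x)
              }
            ; identity = (λ δ x → A.+-identityˡ (D δ x))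
                       , (λ δ x → A.+-identityʳ (D δ x))
            }
          ; comm = λ δ ε x → A.+-comm (D δ x) (D ε x)
          }
        ; isPreleftSemimodule = record
          { *ₗ-cong = λ p q x → cong₂ _•_ p (q x)
          ; *ₗ-zeroˡ = λ δ x → M.*ₗ-zeroˡ (D δ x)
          ; *ₗ-distribʳ = λ δ k l x → M.*ₗ-distribʳ (D δ x) k l
          ; *ₗ-identityˡ = λ δ x → M.*ₗ-identityˡ (D δ x)
          ; *ₗ-assoc = λ k l δ x → M.*ₗ-assoc k l (D δ x)
          ; *ₗ-zeroʳ = λ k x → M.*ₗ-zeroʳ k
          ; *ₗ-distribˡ = λ k δ ε x → M.*ₗ-distribˡ k (D δ x) (D ε x)
          }
        }
      ; -ᴹ‿cong = λ p x → cong ⊖_ (p x)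
      ; -ᴹ‿inverse = (λ δ x → A.-‿inverseˡ (D δ x))
                   , (λ δ x → A.-‿inverseʳ (D δ x))
      }
    }

  Inn : Submodule 𝒟 0ℓ
  Inn = record
    { Member = IsInner
    ; resp   = λ { p (β , h) → β , λ x → trans (sym (p x)) (h x) }
    ; 0-mem  = 𝟘 , λ x → sym (cong₂ (λ u v → u ⊕ ⊖ v)
                                (A.zeroˡ (τ x)) (A.zeroʳ (σ x)))
    ; +-mem  = λ { (β , h) (γ , k) → β ⊕ γ , λ x →
        trans (cong₂ _⊕_ (h x) (k x))
        (trans (A.interchange (β ⊗ τ x) (⊖ (σ x ⊗ β)) (γ ⊗ τ x) (⊖ (σ x ⊗ γ)))
        (cong₂ _⊕_ (sym (A.distribʳ (τ x) β γ))
          (trans (A.⁻¹-∙-comm (σ x ⊗ β) (σ x ⊗ γ))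
                 (cong ⊖_ (sym (A.distribˡ (σ x) β γ)))))) }
    ; *ₗ-mem = λ { k (β , h) → k • β , λ x →
        trans (cong (k •_) (h x))
        (trans (M.*ₗ-distribˡ k (β ⊗ τ x) (⊖ (σ x ⊗ β)))
        (cong₂ _⊕_ (sym (•-⊗ˡ k β (τ x)))
          (trans (•-⊖ k (σ x ⊗ β)) (cong ⊖_ (sym (•-⊗ʳ k (σ x) β)))))) }
    }

  Out : LeftModule +-*-ring 0ℓ 0ℓ
  Out = quotient 𝒟 Inn

{-# OPTIONS --safe #-}

-- A ring endomorphism sends 1 to an idempotent of ℤ[√d], that is to 0 or 1,
-- and a non-zero one therefore fixes ℤ and sends √d to a square root of d.
-- As d is square-free and not 1, the only such roots are ±√d.  Hence
-- {σ , τ} consists of the identity and the conjugation: σ √d = ε√d and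
-- τ √d = -ε√d with ε = ±1.  A derivation D kills 1, so it is
-- determined by D √d, and it is the inner one given by β = p + q√d exactly
-- when D √d = -2ε β√d = -2εqd - 2εp√d.  The derivation
-- a + b√d ↦ b√d takes the value √d at √d and so is outer.
module Submission where

open import Defs
open import Algebra.Bundles using (AbelianGroup; CommutativeRing)
open import Algebra.Module.Bundles using (LeftModule)
open import Algebra.Module.Morphism.Structures using (module LeftModuleMorphisms)
open import Algebra.Morphism.Structures
  using (module GroupMorphisms; module RingWithoutOneMorphisms)
import Algebra.Properties.Group as GroupProperties
open import Data.Integer
  using (ℤ; +_; -[1+_]; 0ℤ; 1ℤ; ∣_∣; ≢-nonZero; _+_; _*_; -_; _-_)
open import Data.Integer.Divisibility.Signed
  using (_∣_; divides; ∣⇒∣ᵤ; ∣-trans; ∣m⇒∣m*n; ∣-refl)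
open import Data.Integer.Properties
  using (i*j≡0⇒i≡0∨j≡0; i-j≡0⇒i≡j; *-cancelˡ-≡;
         *-zeroʳ; *-identityʳ; i≡j⇒i-j≡0)
import Data.Nat as ℕ
open import Data.Nat.Divisibility using (∣1⇒≡1)
open import Data.Integer.Tactic.RingSolver using (solve-∀)
open import Data.Product using (_×_; _,_; proj₂; ∃-syntax)
open import Data.Sum using (_⊎_; inj₁; inj₂; fromInj₂)
open import Function.Bundles using (_⇔_; mk⇔; Equivalence)
open import Relation.Nullary using (¬_; contradiction)
open import Relation.Binary.PropositionalEquality
  using (_≡_; _≢_; refl; sym; trans; cong; cong₂; module ≡-Reasoning)

open ≡-Reasoning

-- Divisibility, square-free integers and signs.

2∤1 : ¬ (+ 2 ∣ 1ℤ)
2∤1 2∣1 with () ← ∣1⇒≡1 (∣⇒∣ᵤ 2∣1)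

∣i∣≡1⇒i*i≡1 : ∀ i → ∣ i ∣ ≡ 1 → i * i ≡ 1ℤ
∣i∣≡1⇒i*i≡1 (+ 1)    refl = refl
∣i∣≡1⇒i*i≡1 -[1+ 0 ] refl = refl

squareFree⇒≢0 : ∀ {d} → SquareFree d → d ≢ 0ℤ
-- The square of 2 divides 0, although 2 is not a unit.
squareFree⇒≢0 sf refl with () ← sf (+ 2) (divides 0ℤ refl)

-- The square `a * a` divides itself, so square-freeness forces `a` to be a unit.
squareFree-square : ∀ {d} → SquareFree d → ∀ a → a * a ≡ d → d ≡ 1ℤ
squareFree-square sf a refl = ∣i∣≡1⇒i*i≡1 a (sf a ∣-refl)

i*i≡j*j⇒i≡±j : ∀ i j → i * i ≡ j * j → i ≡ j ⊎ i ≡ - j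
i*i≡j*j⇒i≡±j i j eq with i*j≡0⇒i≡0∨j≡0 (i - j) (trans (lem i j) (i≡j⇒i-j≡0 eq))
  where
  lem : ∀ i j → (i - j) * (i + j) ≡ i * i - j * j
  lem = solve-∀
... | inj₁ i-j≡0 = inj₁ (i-j≡0⇒i≡j i j i-j≡0)
... | inj₂ i+j≡0 = inj₂ (i-j≡0⇒i≡j i (- j) (trans (lem i j) i+j≡0))
  where
  lem : ∀ i j → i - - j ≡ i + j
  lem = solve-∀

module _ {d : ℤ} where

  open CommutativeRing (commutativeRing d) using (zeroˡ; +-group)
    renaming (+-identityˡ to ⊕-identityˡ; *-identityˡ to ⊗-identityˡ; *-identityʳ to ⊗-identityʳ)
  open GroupProperties +-group using (identityˡ-unique)
  private
    module M = LeftModule (ℤ-module d)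
    G = AbelianGroup.rawGroup M.+ᴹ-abelianGroup

  open GroupMorphisms G G using (IsGroupHomomorphism)

  -- Additive maps on ℤ[√d].

  module _ {f : ℤ[√ d ] → ℤ[√ d ]} (f-hom : IsGroupHomomorphism f) where

    open IsGroupHomomorphism f-hom

    additive⇒ℕ-homogeneous : ∀ n x → f ((+ n) • x) ≡ (+ n) • f x
    additive⇒ℕ-homogeneous ℕ.zero x = begin
      f (0ℤ • x)  ≡⟨ cong f (M.*ₗ-zeroˡ x) ⟩
      f 𝟘         ≡⟨ ε-homo ⟩
      𝟘           ≡⟨ M.*ₗ-zeroˡ (f x) ⟨
      0ℤ • f x    ∎
    additive⇒ℕ-homogeneous (ℕ.suc n) x = begin
      f ((1ℤ + + n) • x)   ≡⟨ cong f (suc-• (+ n) x) ⟩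
      f (x ⊕ (+ n) • x)    ≡⟨ homo x _ ⟩
      f x ⊕ f ((+ n) • x)  ≡⟨ cong (f x ⊕_) (additive⇒ℕ-homogeneous n x) ⟩
      f x ⊕ (+ n) • f x    ≡⟨ suc-• (+ n) (f x) ⟨
      (1ℤ + + n) • f x     ∎
      where
      suc-• : ∀ k (y : ℤ[√ d ]) → (1ℤ + k) • y ≡ y ⊕ k • y
      suc-• k y = trans (M.*ₗ-distribʳ y 1ℤ k) (cong (_⊕ k • y) (M.*ₗ-identityˡ y))

    -- Ring endomorphisms are given only as additive and multiplicative; this supplies their
    -- ℤ-linearity, by induction on naturals and then by negation.
    additive⇒homogeneous : ∀ k x → f (k • x) ≡ k • f x
    additive⇒homogeneous (+ n) x = additive⇒ℕ-homogeneous n x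
    additive⇒homogeneous -[1+ n ] x = begin
      f (- (+ ℕ.suc n) • x)    ≡⟨ cong f (neg-• (+ ℕ.suc n) x) ⟩
      f (⊖ ((+ ℕ.suc n) • x))  ≡⟨ ⁻¹-homo _ ⟩
      ⊖ f ((+ ℕ.suc n) • x)    ≡⟨ cong ⊖_ (additive⇒ℕ-homogeneous (ℕ.suc n) x) ⟩
      ⊖ ((+ ℕ.suc n) • f x)    ≡⟨ neg-• (+ ℕ.suc n) (f x) ⟨
      - (+ ℕ.suc n) • f x      ∎
      where
      neg-• : ∀ k (y : ℤ[√ d ]) → (- k) • y ≡ ⊖ (k • y)
      neg-• k (a +√ b) = cong₂ _+√_ (lem k a) (lem k b)
        where
        lem : ∀ k i → - k * i ≡ - (k * i)
        lem = solve-∀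

    -- Since 1 and √d generate ℤ[√d] additively, two values determine `f`. Endomorphisms and
    -- derivations are both computed this way.
    additive-expand : ∀ x → f x ≡ re x • f 𝟙 ⊕ im x • f (√ d)
    additive-expand x@(a +√ b) = begin
      f x                          ≡⟨ cong f (cong₂ _+√_ (lem₁ a b) (lem₂ a b)) ⟩
      f (a • 𝟙 ⊕ b • √ d)          ≡⟨ homo _ _ ⟩
      f (a • 𝟙) ⊕ f (b • √ d)      ≡⟨ cong₂ _⊕_ (additive⇒homogeneous a 𝟙)
                                                (additive⇒homogeneous b (√ d)) ⟩
      a • f 𝟙 ⊕ b • f (√ d)        ∎
      where
      lem₁ : ∀ a b → a ≡ a * 1ℤ + b * 0ℤ
      lem₁ = solve-∀
      lem₂ : ∀ a b → b ≡ a * 0ℤ + b * 1ℤ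
      lem₂ = solve-∀

  -- Idempotents and square roots of d.

  idempotent⇒𝟘∨𝟙 : (e : ℤ[√ d ]) → e ⊗ e ≡ e → e ≡ 𝟘 ⊎ e ≡ 𝟙
  idempotent⇒𝟘∨𝟙 (a +√ b) idem
    with i*j≡0⇒i≡0∨j≡0 b (trans (lem a b) (i≡j⇒i-j≡0 (cong im idem)))
    where
    lem : ∀ a b → b * (a * + 2 - 1ℤ) ≡ (a * b + b * a) - b
    lem = solve-∀
  -- The imaginary part of `e ⊗ e ≡ e` reads b(2a - 1) = 0, and 2a = 1 fails by parity. With b = 0
  -- the real part leaves a(a - 1) = 0.
  ... | inj₂ 2a-1≡0 =
    contradiction (divides a (sym (i-j≡0⇒i≡j (a * + 2) 1ℤ 2a-1≡0))) 2∤1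
  ... | inj₁ refl
    with i*j≡0⇒i≡0∨j≡0 a (trans (lem d a) (i≡j⇒i-j≡0 (cong re idem)))
    where
    lem : ∀ d a → a * (a - 1ℤ) ≡ (a * a + d * (0ℤ * 0ℤ)) - a
    lem = solve-∀
  ... | inj₁ refl = inj₁ refl
  ... | inj₂ a-1≡0 = inj₂ (cong (_+√ 0ℤ) (i-j≡0⇒i≡j a 1ℤ a-1≡0))

  -- The imaginary part of s² = d gives 2ab = 0. If b = 0, then d = a² is a square-free square,
  -- hence 1; if a = 0, then db² = d and b is the sign sought. Writing a sign as `ε * ε ≡ 1ℤ` lets
  -- later identities treat both signs at once.
  square-roots-of-d : SquareFree d → d ≢ 1ℤ → (s : ℤ[√ d ]) → s ⊗ s ≡ d • 𝟙 →
    ∃[ ε ] ε * ε ≡ 1ℤ × s ≡ ε • √ d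
  square-roots-of-d sf d≢1 (a +√ b) s²≡d
    with i*j≡0⇒i≡0∨j≡0 (+ 2 * a) (trans (lem₁ a b) (trans (cong im s²≡d) (*-zeroʳ d)))
    where
    lem₁ : ∀ a b → + 2 * a * b ≡ a * b + b * a
    lem₁ = solve-∀
  ... | inj₂ refl = contradiction
    (squareFree-square sf a
      (trans (lem d a) (trans (cong re s²≡d) (*-identityʳ d))))
    d≢1
    where
    lem : ∀ d a → a * a ≡ a * a + d * (0ℤ * 0ℤ)
    lem = solve-∀
  ... | inj₁ 2a≡0 with refl ← *-cancelˡ-≡ (+ 2) a 0ℤ 2a≡0 =
    b ,
    *-cancelˡ-≡ d (b * b) 1ℤ {{≢-nonZero (squareFree⇒≢0 sf)}}
      (trans (lem d b) (cong re s²≡d)) ,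
    cong₂ _+√_ (sym (*-zeroʳ b)) (sym (*-identityʳ b))
    where
    lem : ∀ d b → d * (b * b) ≡ 0ℤ * 0ℤ + d * (b * b)
    lem = solve-∀

  -- Non-zero ring endomorphisms.

  signed : ℤ → ℤ[√ d ] → ℤ[√ d ]
  signed ε (a +√ b) = a +√ ε * b

  module _ (sf : SquareFree d) (d≢1 : d ≢ 1ℤ)
           {σ : ℤ[√ d ] → ℤ[√ d ]} (σ-hom : IsRingEndomorphism σ) (σ≢0 : IsNonZero σ) where

    open RingWithoutOneMorphisms.IsRingWithoutOneHomomorphism σ-hom

    -- The image of 1 is idempotent; were it 0, σ x = σ 1 · σ x would vanish everywhere.
    endomorphism-𝟙 : σ 𝟙 ≡ 𝟙
    endomorphism-𝟙 = fromInj₂ (λ σ1≡𝟘 → contradiction (σ≡𝟘 σ1≡𝟘) σ≢0)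
      (idempotent⇒𝟘∨𝟙 (σ 𝟙) (trans (sym (*-homo 𝟙 𝟙)) (cong σ (⊗-identityˡ 𝟙))))
      where
      σ≡𝟘 : σ 𝟙 ≡ 𝟘 → ∀ x → σ x ≡ 𝟘
      σ≡𝟘 σ1≡𝟘 x = begin
        σ x        ≡⟨ cong σ (⊗-identityˡ x) ⟨
        σ (𝟙 ⊗ x)  ≡⟨ *-homo 𝟙 x ⟩
        σ 𝟙 ⊗ σ x  ≡⟨ cong (_⊗ σ x) σ1≡𝟘 ⟩
        𝟘 ⊗ σ x    ≡⟨ zeroˡ (σ x) ⟩
        𝟘          ∎

    endomorphism-√d² : σ (√ d) ⊗ σ (√ d) ≡ d • 𝟙
    endomorphism-√d² = begin
      σ (√ d) ⊗ σ (√ d)  ≡⟨ *-homo (√ d) (√ d) ⟨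
      σ (√ d ⊗ √ d)      ≡⟨ cong σ (cong₂ _+√_ (lem₁ d) (lem₂ d)) ⟩
      σ (d • 𝟙)          ≡⟨ additive⇒homogeneous +-isGroupHomomorphism d 𝟙 ⟩
      d • σ 𝟙            ≡⟨ cong (d •_) endomorphism-𝟙 ⟩
      d • 𝟙              ∎
      where
      lem₁ : ∀ d → 0ℤ * 0ℤ + d * (1ℤ * 1ℤ) ≡ d * 1ℤ
      lem₁ = solve-∀
      lem₂ : ∀ d → 0ℤ * 1ℤ + 1ℤ * 0ℤ ≡ d * 0ℤ
      lem₂ = solve-∀

    endomorphism-signed : ∃[ ε ] ε * ε ≡ 1ℤ × (∀ x → σ x ≡ signed ε x)
    endomorphism-signed =
      let ε , ε²≡1 , σ√d = square-roots-of-d sf d≢1 (σ (√ d)) endomorphism-√d²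
      in ε , ε²≡1 , expand ε σ√d
      where
      expand : ∀ ε → σ (√ d) ≡ ε • √ d → ∀ x → σ x ≡ signed ε x
      expand ε σ√d x@(a +√ b) = begin
        σ x                       ≡⟨ additive-expand +-isGroupHomomorphism x ⟩
        a • σ 𝟙 ⊕ b • σ (√ d)     ≡⟨ cong₂ (λ u v → a • u ⊕ b • v) endomorphism-𝟙 σ√d ⟩
        a • 𝟙 ⊕ b • ε • √ d       ≡⟨ cong₂ _+√_ (lem₁ ε a b) (lem₂ ε a b) ⟩
        signed ε x                ∎
        where
        lem₁ : ∀ ε a b → a * 1ℤ + b * (ε * 0ℤ) ≡ a
        lem₁ = solve-∀
        lem₂ : ∀ ε a b → a * 0ℤ + b * (ε * 1ℤ) ≡ ε * b
        lem₂ = solve-∀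

  signed-opposite : ∀ ε η → ε * ε ≡ 1ℤ → η * η ≡ 1ℤ →
    ¬ ((x : ℤ[√ d ]) → signed ε x ≡ signed η x) → η ≡ - ε
  signed-opposite ε η ε²≡1 η²≡1 ε≢η =
    fromInj₂ (λ η≡ε → contradiction (λ x → cong (λ ζ → signed ζ x) (sym η≡ε)) ε≢η)
      (i*i≡j*j⇒i≡±j η ε (trans η²≡1 (sym ε²≡1)))

  distinct-endomorphisms-opposite : SquareFree d → d ≢ 1ℤ →
    {σ τ : ℤ[√ d ] → ℤ[√ d ]} → IsRingEndomorphism σ → IsRingEndomorphism τ →
    IsNonZero σ → IsNonZero τ → ¬ (∀ x → σ x ≡ τ x) →
    ∃[ ε ] ε * ε ≡ 1ℤ × (∀ x → σ x ≡ signed ε x) × (∀ x → τ x ≡ signed (- ε) x)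
  distinct-endomorphisms-opposite sf d≢1 {σ} {τ} σ-hom τ-hom σ≢0 τ≢0 σ≢τ =
    let ε , ε²≡1 , σ-signed = endomorphism-signed sf d≢1 σ-hom σ≢0
        η , η²≡1 , τ-signed = endomorphism-signed sf d≢1 τ-hom τ≢0
        η≡-ε = signed-opposite ε η ε²≡1 η²≡1
          (λ ε≗η → σ≢τ (λ x → trans (σ-signed x) (trans (ε≗η x) (sym (τ-signed x)))))
    in ε , ε²≡1 , σ-signed , λ x → trans (τ-signed x) (cong (λ ζ → signed ζ x) η≡-ε)

  -- Derivations and the criterion for being inner.

  module _ {σ τ : ℤ[√ d ] → ℤ[√ d ]} (ε : ℤ) (ε²≡1 : ε * ε ≡ 1ℤ)
           (σ-signed : ∀ x → σ x ≡ signed ε x) (τ-signed : ∀ x → τ x ≡ signed (- ε) x) where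

    -- By commutativity the contributions of the real part of `x` cancel, while those of √d add up,
    -- as σ and τ have opposite signs.
    inner-value : ∀ β x →
      (β ⊗ τ x) ⊕ ⊖ (σ x ⊗ β) ≡ im x • (- (+ 2 * ε)) • (β ⊗ √ d)
    inner-value β@(p +√ q) x@(a +√ b) = begin
      (β ⊗ τ x) ⊕ ⊖ (σ x ⊗ β)                    ≡⟨ cong₂ (λ u v → (β ⊗ u) ⊕ ⊖ (v ⊗ β))
                                                      (τ-signed x) (σ-signed x) ⟩
      (β ⊗ signed (- ε) x) ⊕ ⊖ (signed ε x ⊗ β)  ≡⟨ cong₂ _+√_ (lem₁ d ε p q a b)
                                                               (lem₂ ε p q a b) ⟩
      b • (- (+ 2 * ε)) • (β ⊗ √ d)              ∎
      where
      lem₁ : ∀ d ε p q a b →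
        (p * a + d * (q * (- ε * b))) + - (a * p + d * (ε * b * q)) ≡
        b * (- (+ 2 * ε) * (p * 0ℤ + d * (q * 1ℤ)))
      lem₁ = solve-∀
      lem₂ : ∀ ε p q a b →
        (p * (- ε * b) + q * a) + - (a * q + ε * b * p) ≡
        b * (- (+ 2 * ε) * (p * 1ℤ + q * 0ℤ))
      lem₂ = solve-∀

    module _ (δ : Derivation σ τ) where

      open Derivation δ
      open LeftModuleMorphisms.IsLeftModuleHomomorphism linear using (+ᴹ-isGroupHomomorphism)

      -- Both σ and τ fix 1, so the Leibniz rule at 1 · 1 gives D 1 = D 1 + D 1.
      derivation-𝟙 : D 𝟙 ≡ 𝟘
      derivation-𝟙 = identityˡ-unique (D 𝟙) (D 𝟙) (sym (begin
        D 𝟙                          ≡⟨ cong D (⊗-identityˡ 𝟙) ⟨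
        D (𝟙 ⊗ 𝟙)                    ≡⟨ leibniz 𝟙 𝟙 ⟩
        (D 𝟙 ⊗ τ 𝟙) ⊕ (σ 𝟙 ⊗ D 𝟙)    ≡⟨ cong₂ (λ u v → (D 𝟙 ⊗ u) ⊕ (v ⊗ D 𝟙))
                                         (trans (τ-signed 𝟙) (signed-𝟙 (- ε)))
                                         (trans (σ-signed 𝟙) (signed-𝟙 ε)) ⟩
        (D 𝟙 ⊗ 𝟙) ⊕ (𝟙 ⊗ D 𝟙)        ≡⟨ cong₂ _⊕_ (⊗-identityʳ (D 𝟙)) (⊗-identityˡ (D 𝟙)) ⟩
        D 𝟙 ⊕ D 𝟙                    ∎))
        where
        signed-𝟙 : ∀ η → signed η 𝟙 ≡ 𝟙
        signed-𝟙 η = cong (1ℤ +√_) (*-zeroʳ η)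

      derivation-expand : ∀ x → D x ≡ im x • D (√ d)
      derivation-expand x = begin
        D x                           ≡⟨ additive-expand +ᴹ-isGroupHomomorphism x ⟩
        re x • D 𝟙 ⊕ im x • D (√ d)   ≡⟨ cong (λ u → re x • u ⊕ im x • D (√ d)) derivation-𝟙 ⟩
        re x • 𝟘 ⊕ im x • D (√ d)     ≡⟨ cong (_⊕ im x • D (√ d)) (M.*ₗ-zeroʳ (re x)) ⟩
        𝟘 ⊕ im x • D (√ d)            ≡⟨ ⊕-identityˡ _ ⟩
        im x • D (√ d)                ∎

      -- For β = p + q√d, multiplication by √d swaps the coordinates into qd + p√d. Hence `q`
      -- governs `c₀`, with the extra factor d, and `p` governs `c₁`.
      inner⇔ : ∀ c₀ c₁ → D (√ d) ≡ (c₀ +√ c₁) →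
        IsInner σ τ δ ⇔ ((+ 2 * d ∣ c₀) × (+ 2 ∣ c₁))
      inner⇔ c₀ c₁ D√d = mk⇔ to from
        where
        to : IsInner σ τ δ → (+ 2 * d ∣ c₀) × (+ 2 ∣ c₁)
        to (β@(p +√ q) , inner) =
            divides (- (ε * q)) (trans (cong re value) (lem₁ d ε p q))
          , divides (- (ε * p)) (trans (cong im value) (lem₂ ε p q))
          where
          value : c₀ +√ c₁ ≡ 1ℤ • (- (+ 2 * ε)) • (β ⊗ √ d)
          value = trans (sym D√d) (trans (inner (√ d)) (inner-value β (√ d)))
          lem₁ : ∀ d ε p q →
            1ℤ * (- (+ 2 * ε) * (p * 0ℤ + d * (q * 1ℤ))) ≡ - (ε * q) * (+ 2 * d)
          lem₁ = solve-∀
          lem₂ : ∀ ε p q →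
            1ℤ * (- (+ 2 * ε) * (p * 1ℤ + q * 0ℤ)) ≡ - (ε * p) * + 2
          lem₂ = solve-∀

        from : (+ 2 * d ∣ c₀) × (+ 2 ∣ c₁) → IsInner σ τ δ
        from (divides k c₀≡ , divides l c₁≡) = β , λ x → begin
          D x                                  ≡⟨ derivation-expand x ⟩
          im x • D (√ d)                       ≡⟨ cong (im x •_) (trans D√d value) ⟩
          im x • (- (+ 2 * ε)) • (β ⊗ √ d)     ≡⟨ inner-value β x ⟨
          (β ⊗ τ x) ⊕ ⊖ (σ x ⊗ β)              ∎
          where
          β : ℤ[√ d ]
          -- Solves 2dk = -2εqd and 2l = -2εp for q and p, using that ε is its own inverse.
          β = - (ε * l) +√ - (ε * k)
          lem₁ : ∀ d ε k l →
            ε * ε * (k * (+ 2 * d)) ≡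
            - (+ 2 * ε) * (- (ε * l) * 0ℤ + d * (- (ε * k) * 1ℤ))
          lem₁ = solve-∀
          lem₂ : ∀ ε k l →
            ε * ε * (l * + 2) ≡ - (+ 2 * ε) * (- (ε * l) * 1ℤ + - (ε * k) * 0ℤ)
          lem₂ = solve-∀
          value : c₀ +√ c₁ ≡ (- (+ 2 * ε)) • (β ⊗ √ d)
          value = begin
            c₀ +√ c₁                                  ≡⟨ cong₂ _+√_ c₀≡ c₁≡ ⟩
            k * (+ 2 * d) +√ l * + 2                  ≡⟨ M.*ₗ-identityˡ _ ⟨
            -- The factor 1 becomes `ε * ε`: one ε belongs to the scalar -2ε, the other to `β`.
            1ℤ • (k * (+ 2 * d) +√ l * + 2)           ≡⟨ cong (_• _) ε²≡1 ⟨
            (ε * ε) • (k * (+ 2 * d) +√ l * + 2)      ≡⟨ cong₂ _+√_ (lem₁ d ε k l) (lem₂ ε k l) ⟩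
            (- (+ 2 * ε)) • (β ⊗ √ d)                 ∎

    -- An outer derivation.

    imaginary-part : Derivation σ τ
    imaginary-part = mkDerivation σ τ (λ x → im x • √ d)
      (λ x y → M.*ₗ-distribʳ (√ d) (im x) (im y))
      (λ k x → M.*ₗ-assoc k (im x) (√ d))
      leib
      where
      leib : ∀ x y → im (x ⊗ y) • √ d ≡ ((im x • √ d) ⊗ τ y) ⊕ (σ x ⊗ (im y • √ d))
      leib x@(a +√ b) y@(a′ +√ b′) = begin
        im (x ⊗ y) • √ d
          -- The two products of √d-parts, -εdbb′ from τ and εdbb′ from σ, cancel; this is where the
          -- opposite signs make the Leibniz rule hold.
          ≡⟨ cong₂ _+√_ (lem₁ d ε a b a′ b′) (lem₂ ε a b a′ b′) ⟩
        ((b • √ d) ⊗ signed (- ε) y) ⊕ (signed ε x ⊗ (b′ • √ d))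
          ≡⟨ cong₂ (λ u v → ((b • √ d) ⊗ u) ⊕ (v ⊗ (b′ • √ d))) (τ-signed y) (σ-signed x) ⟨
        ((b • √ d) ⊗ τ y) ⊕ (σ x ⊗ (b′ • √ d)) ∎
        where
        lem₁ : ∀ d ε a b a′ b′ → (a * b′ + b * a′) * 0ℤ ≡
          (b * 0ℤ * a′ + d * (b * 1ℤ * (- ε * b′))) +
          (a * (b′ * 0ℤ) + d * (ε * b * (b′ * 1ℤ)))
        lem₁ = solve-∀
        lem₂ : ∀ ε a b a′ b′ → (a * b′ + b * a′) * 1ℤ ≡
          (b * 0ℤ * (- ε * b′) + b * 1ℤ * a′) +
          (a * (b′ * 1ℤ) + ε * b * (b′ * 0ℤ))
        lem₂ = solve-∀

    out-nonTrivial : NonTrivial (Out σ τ)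
    out-nonTrivial = imaginary-part , λ inner →
      -- Vanishing in the quotient means that the difference with the zero derivation is inner. That
      -- difference evaluates at √d to 0 + 1√d, and 1 is odd.
      2∤1 (proj₂ (Equivalence.to (inner⇔ (imaginary-part 𝒟.+ᴹ 𝒟.-ᴹ 𝒟.0ᴹ) 0ℤ 1ℤ refl) inner))
      where
      module 𝒟 = LeftModule (𝒟 σ τ)

theorem3p4 : (d : ℤ) → SquareFree d → ¬ (+ 4 ∣ d - + 1) →
    (σ τ : ℤ[√ d ] → ℤ[√ d ]) →
    IsRingEndomorphism σ → IsRingEndomorphism τ →
    IsNonZero σ → IsNonZero τ → ¬ (∀ x → σ x ≡ τ x) →
    ((δ : Derivation σ τ) (c₀ c₁ : ℤ) →
    Derivation.D δ (√ d) ≡ (c₀ +√ c₁) →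
    (IsInner σ τ δ ⇔ ((+ 2 * d ∣ c₀) × (+ 2 ∣ c₁)))
    × ((+ 2 * d ∣ c₀) × (+ 2 * d ∣ c₁) → IsInner σ τ δ))
    × NonTrivial (Out σ τ)
theorem3p4 d sf d≢1[4] σ τ σ-hom τ-hom σ≢0 τ≢0 σ≢τ =
  let ε , ε²≡1 , σ-signed , τ-signed =
        distinct-endomorphisms-opposite sf d≢1 σ-hom τ-hom σ≢0 τ≢0 σ≢τ
  in
    (λ δ c₀ c₁ D√d →
      let criterion = inner⇔ {σ = σ} {τ = τ} ε ε²≡1 σ-signed τ-signed δ c₀ c₁ D√d in
        criterion
      , λ (2d∣c₀ , 2d∣c₁) →
          -- Since 2 divides 2d, it divides `c₁`.
          Equivalence.from criterion (2d∣c₀ , ∣-trans (∣m⇒∣m*n d ∣-refl) 2d∣c₁))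
  , out-nonTrivial {σ = σ} {τ = τ} ε ε²≡1 σ-signed τ-signed
  where
  d≢1 : d ≢ 1ℤ
  -- For d = 1 the difference d - 1 is 0, a multiple of 4.
  d≢1 refl = d≢1[4] (divides 0ℤ refl)
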